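{- There is no infinite sequence $(\mathcal D_Y^{(1)},\mathcal D_N^{(1)}),(\mathcal D_Y^{(2)},\mathcal D_N^{(2)}),\ldots$ of padded one-wise pairs of distributions in $\Delta_3$ such that $$\lim_{t\to\infty}\frac{\beta_{\{3\}}(\mathcal D_N^{(t)})}{\gamma_{\{3\}}(\mathcal D_Y^{(t)})}=\frac29.$$
   Context: $\Delta_k$ is the set of symmetric probability distributions on $\{ -1,1\}^k$ (vectors with the same number of $1$'s are equiprobable). For $\mathcal D\in\Delta_k$, $\mu(\mathcal D)=\mathbb E_{\mathbf b\sim\mathcal D}[b_1]$. For $S\subseteq[k]$, $f_{S,k}(\mathbf x)=1$ iff the number of coordinates of $\mathbf x\in\{ -1,1\}^k$ equal to $1$ lies in $S$ (and $0$ otherwise); $f_{\{3\},3}$ is the AND function on three bits. With $\mathrm{Bern}(p)$ equal to $1$ with probability $p$ and $-1$ with probability $1-p$, and $\odot$ the coordinatewise product, $\lambda_S(\mathcal D,p)=\mathbb E_{\mathbf a\sim\mathcal D,\ \mathbf b\sim\mathrm{Bern}(p)^k}[f_{S,k}(\mathbf a\odot\mathbf b)]$, $\beta_S(\mathcal D)=\sup_{p\in[0,1]}\lambda_S(\mathcal D,p)$ and $\gamma_S(\mathcal D)=\lambda_S(\mathcal D,1)$. Ratios with zero denominator are taken to be $+\infty$. A pair $(\mathcal D_Y,\mathcal D_N)$ of distributions in $\Delta_k$ is a *padded one-wise pair* if there exist $\tau\in[0,1]$ and $\mathcal D_0,\mathcal D'_Y,\mathcal D'_N\in\Delta_k$ such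 that $\mu(\mathcal D'_Y)=\mu(\mathcal D'_N)=0$, $\mathcal D_Y=\tau\mathcal D_0+(1-\tau)\mathcal D'_Y$ and $\mathcal D_N=\tau\mathcal D_0+(1-\tau)\mathcal D'_N$. -}

module Defs where

open import Data.List using (List)
open import Data.List.Membership.DecPropositional using (_∈?_)
open import Data.Nat as ℕ using (ℕ; zero; suc; _⊔_)
import Data.Nat.Properties as ℕ
open import Data.Product using (_×_; _,_; ∃-syntax)
open import Data.Rational as ℚ using (ℚ; 0ℚ; 1ℚ; ½)
import Data.Rational.Properties as ℚ
open import Data.Rational.Solver using (module +-*-Solver)
open import Data.Sign as Sign using (Sign)
import Data.Sign.Properties as Sign
open import Data.Empty using (⊥)
open import Data.Vec using (Vec; []; _∷_; head; count; zipWith)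
open import Relation.Binary.PropositionalEquality
  using (_≡_; refl; sym; cong; cong₂; subst)
open import Relation.Nullary using (¬_; yes; no)

------------------------------------------------------------------------
-- Real numbers: Cauchy sequences of rationals, with setoid equality.
-- Since the modulus of convergence is existentially quantified rather
-- than fixed, all the ring operations are pointwise.

Eventually : (ℕ → Set) → Set
Eventually P = ∃[ N ] (∀ n → N ℕ.≤ n → P n)

IsCauchy : (ℕ → ℚ) → Set
IsCauchy x = ∀ ε → 0ℚ ℚ.< ε →
  ∃[ N ] (∀ m n → N ℕ.≤ m → N ℕ.≤ n → ℚ.∣ x m ℚ.- x n ∣ ℚ.< ε)

record ℝ : Set where
  constructor mkℝ
  field
    seq    : ℕ → ℚ
    cauchy : IsCauchy seq

open ℝ public

infix 4 _≈_ _≤_ _<_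

_≈_ : ℝ → ℝ → Set
x ≈ y = ∀ ε → 0ℚ ℚ.< ε → Eventually λ n → ℚ.∣ seq x n ℚ.- seq y n ∣ ℚ.< ε

_≤_ : ℝ → ℝ → Set
x ≤ y = ∀ ε → 0ℚ ℚ.< ε → Eventually λ n → seq x n ℚ.< seq y n ℚ.+ ε

_<_ : ℝ → ℝ → Set
x < y = ∃[ ε ] (0ℚ ℚ.< ε × Eventually λ n → seq x n ℚ.+ ε ℚ.< seq y n)

module CauchyProperties where
  open ℚ.≤-Reasoning
  open +-*-Solver

  0<½ε : ∀ {ε} → 0ℚ ℚ.< ε → 0ℚ ℚ.< ½ ℚ.* ε
  0<½ε {ε} 0<ε = ℚ.*-monoʳ-<-pos ½ 0<ε

  halves : ∀ ε → ½ ℚ.* ε ℚ.+ ½ ℚ.* ε ≡ ε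
  halves = solve 1 (λ ε → con ½ :* ε :+ con ½ :* ε := ε) refl

  sum-diff : ∀ a b c d → (a ℚ.+ b) ℚ.- (c ℚ.+ d) ≡ (a ℚ.- c) ℚ.+ (b ℚ.- d)
  sum-diff = solve 4 (λ a b c d → (a :+ b) :- (c :+ d) := (a :- c) :+ (b :- d)) refl

  neg-diff : ∀ a b → ℚ.- a ℚ.- ℚ.- b ≡ ℚ.- (a ℚ.- b)
  neg-diff = solve 2 (λ a b → :- a :- :- b := :- (a :- b)) refl

  diff-sum : ∀ a b → a ≡ (a ℚ.- b) ℚ.+ b
  diff-sum = solve 2 (λ a b → a := (a :- b) :+ b) refl

  prod-diff : ∀ a b c d → a ℚ.* b ℚ.- c ℚ.* d ≡ a ℚ.* (b ℚ.- d) ℚ.+ d ℚ.* (a ℚ.- c)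
  prod-diff = solve 4 (λ a b c d → a :* b :- c :* d := a :* (b :- d) :+ d :* (a :- c)) refl

  +-cauchy : ∀ x y → IsCauchy x → IsCauchy y →
             IsCauchy (λ n → x n ℚ.+ y n)
  +-cauchy x y cx cy ε 0<ε with cx (½ ℚ.* ε) (0<½ε 0<ε)
                                | cy (½ ℚ.* ε) (0<½ε 0<ε)
  ... | M , p | N , q = M ⊔ N , λ m n m≥ n≥ → begin-strict
    ℚ.∣ (x m ℚ.+ y m) ℚ.- (x n ℚ.+ y n) ∣
      ≡⟨ cong ℚ.∣_∣ (sum-diff (x m) (y m) (x n) (y n)) ⟩
    ℚ.∣ (x m ℚ.- x n) ℚ.+ (y m ℚ.- y n) ∣
      ≤⟨ ℚ.∣p+q∣≤∣p∣+∣q∣ (x m ℚ.- x n) (y m ℚ.- y n) ⟩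
    ℚ.∣ x m ℚ.- x n ∣ ℚ.+ ℚ.∣ y m ℚ.- y n ∣
      <⟨ ℚ.+-mono-< (p m n (ℕ.m⊔n≤o⇒m≤o M N m≥) (ℕ.m⊔n≤o⇒m≤o M N n≥))
                    (q m n (ℕ.m⊔n≤o⇒n≤o M N m≥) (ℕ.m⊔n≤o⇒n≤o M N n≥)) ⟩
    ½ ℚ.* ε ℚ.+ ½ ℚ.* ε
      ≡⟨ halves ε ⟩
    ε ∎

  neg-cauchy : ∀ x → IsCauchy x → IsCauchy (λ n → ℚ.- x n)
  neg-cauchy x cx ε 0<ε with cx ε 0<ε
  ... | N , p = N , λ m n m≥ n≥ → begin-strict
    ℚ.∣ ℚ.- x m ℚ.- ℚ.- x n ∣
      ≡⟨ cong ℚ.∣_∣ (neg-diff (x m) (x n)) ⟩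
    ℚ.∣ ℚ.- (x m ℚ.- x n) ∣
      ≡⟨ ℚ.∣-p∣≡∣p∣ (x m ℚ.- x n) ⟩
    ℚ.∣ x m ℚ.- x n ∣
      <⟨ p m n m≥ n≥ ⟩
    ε ∎

  EventuallyBounded : (ℕ → ℚ) → Set
  EventuallyBounded x = ∃[ B ] (0ℚ ℚ.< B × Eventually λ n → ℚ.∣ x n ∣ ℚ.≤ B)

  bounded : ∀ x → IsCauchy x → EventuallyBounded x
  bounded x cx with cx 1ℚ (ℚ.positive⁻¹ 1ℚ)
  ... | N , p = 1ℚ ℚ.+ ℚ.∣ x N ∣ ,
    ℚ.+-mono-<-≤ (ℚ.positive⁻¹ 1ℚ) (ℚ.0≤∣p∣ (x N)) ,
    N , λ n n≥ → begin
    ℚ.∣ x n ∣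
      ≡⟨ cong ℚ.∣_∣ (diff-sum (x n) (x N)) ⟩
    ℚ.∣ (x n ℚ.- x N) ℚ.+ x N ∣
      ≤⟨ ℚ.∣p+q∣≤∣p∣+∣q∣ (x n ℚ.- x N) (x N) ⟩
    ℚ.∣ x n ℚ.- x N ∣ ℚ.+ ℚ.∣ x N ∣
      ≤⟨ ℚ.+-monoˡ-≤ ℚ.∣ x N ∣ (ℚ.<⇒≤ (p n N n≥ ℕ.≤-refl)) ⟩
    1ℚ ℚ.+ ℚ.∣ x N ∣ ∎

  -- A positive δ with B * δ ≡ η.
  divide : ∀ {B η} → 0ℚ ℚ.< B → 0ℚ ℚ.< η → ∃[ δ ] (0ℚ ℚ.< δ × B ℚ.* δ ≡ η)
  divide {B} {η} 0<B 0<η = B⁻¹ ℚ.* η , 0<δ , (begin-equality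
    B ℚ.* (B⁻¹ ℚ.* η)  ≡⟨ ℚ.*-assoc B B⁻¹ η ⟨
    (B ℚ.* B⁻¹) ℚ.* η  ≡⟨ cong (ℚ._* η) (ℚ.*-inverseʳ B) ⟩
    1ℚ ℚ.* η           ≡⟨ ℚ.*-identityˡ η ⟩
    η ∎)
    where
    instance
      B-pos = ℚ.positive 0<B
      B-nonZero = ℚ.pos⇒nonZero B
    B⁻¹ = ℚ.1/ B
    instance
      B⁻¹-pos = ℚ.1/pos⇒pos B
    0<δ : 0ℚ ℚ.< B⁻¹ ℚ.* η
    0<δ = subst (ℚ._< B⁻¹ ℚ.* η) (ℚ.*-zeroʳ B⁻¹) (ℚ.*-monoʳ-<-pos B⁻¹ 0<η)

  -- If ∣ a ∣ ≤ B and ∣ b ∣ < δ then ∣ a * b ∣ ≤ B * δ.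
  ∣*∣-mono : ∀ {a b B δ} → 0ℚ ℚ.< δ → ℚ.∣ a ∣ ℚ.≤ B → ℚ.∣ b ∣ ℚ.< δ →
             ℚ.∣ a ℚ.* b ∣ ℚ.≤ B ℚ.* δ
  ∣*∣-mono {a} {b} {B} {δ} 0<δ a≤B b<δ = begin
    ℚ.∣ a ℚ.* b ∣          ≡⟨ ℚ.∣p*q∣≡∣p∣*∣q∣ a b ⟩
    ℚ.∣ a ∣ ℚ.* ℚ.∣ b ∣
      ≤⟨ ℚ.*-monoˡ-≤-nonNeg ℚ.∣ a ∣ {{ℚ.nonNegative (ℚ.0≤∣p∣ a)}} (ℚ.<⇒≤ b<δ) ⟩
    ℚ.∣ a ∣ ℚ.* δ
      ≤⟨ ℚ.*-monoʳ-≤-nonNeg δ {{ℚ.nonNegative (ℚ.<⇒≤ 0<δ)}} a≤B ⟩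
    B ℚ.* δ ∎

  *-close : ∀ {a b c d A B δ η θ} → 0ℚ ℚ.< δ → 0ℚ ℚ.< η →
            ℚ.∣ a ∣ ℚ.≤ A → ℚ.∣ d ∣ ℚ.≤ B →
            ℚ.∣ b ℚ.- d ∣ ℚ.< δ → ℚ.∣ a ℚ.- c ∣ ℚ.< η →
            A ℚ.* δ ≡ θ → B ℚ.* η ≡ θ →
            ℚ.∣ a ℚ.* b ℚ.- c ℚ.* d ∣ ℚ.≤ θ ℚ.+ θ
  *-close {a} {b} {c} {d} {A} {B} {δ} {η} {θ} 0<δ 0<η a≤A d≤B b-d<δ a-c<η Aδ≡θ Bη≡θ = begin
    ℚ.∣ a ℚ.* b ℚ.- c ℚ.* d ∣
      ≡⟨ cong ℚ.∣_∣ (prod-diff a b c d) ⟩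
    ℚ.∣ a ℚ.* (b ℚ.- d) ℚ.+ d ℚ.* (a ℚ.- c) ∣
      ≤⟨ ℚ.∣p+q∣≤∣p∣+∣q∣ (a ℚ.* (b ℚ.- d)) (d ℚ.* (a ℚ.- c)) ⟩
    ℚ.∣ a ℚ.* (b ℚ.- d) ∣ ℚ.+ ℚ.∣ d ℚ.* (a ℚ.- c) ∣
      ≤⟨ ℚ.+-mono-≤ (∣*∣-mono {a} {b ℚ.- d} 0<δ a≤A b-d<δ)
                    (∣*∣-mono {d} {a ℚ.- c} 0<η d≤B a-c<η) ⟩
    A ℚ.* δ ℚ.+ B ℚ.* η
      ≡⟨ cong₂ ℚ._+_ Aδ≡θ Bη≡θ ⟩
    θ ℚ.+ θ ∎

  half< : ∀ {ε} → 0ℚ ℚ.< ε → ½ ℚ.* ε ℚ.< ε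
  half< {ε} 0<ε = begin-strict
    ½ ℚ.* ε              ≡⟨ ℚ.+-identityʳ (½ ℚ.* ε) ⟨
    ½ ℚ.* ε ℚ.+ 0ℚ       <⟨ ℚ.+-monoʳ-< (½ ℚ.* ε) (0<½ε 0<ε) ⟩
    ½ ℚ.* ε ℚ.+ ½ ℚ.* ε  ≡⟨ halves ε ⟩
    ε ∎

  *-cauchy′ : ∀ {x y θ ε} → IsCauchy x → IsCauchy y →
              0ℚ ℚ.< θ → θ ℚ.+ θ ℚ.< ε →
              ∃[ N ] (∀ m n → N ℕ.≤ m → N ℕ.≤ n →
                ℚ.∣ x m ℚ.* y m ℚ.- x n ℚ.* y n ∣ ℚ.< ε)
  *-cauchy′ {x} {y} {θ} cx cy 0<θ 2θ<ε =
    let A , 0<A , K , x≤A = bounded x cx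
        B , 0<B , L , y≤B = bounded y cy
        δ , 0<δ , Aδ≡θ = divide 0<A 0<θ
        η , 0<η , Bη≡θ = divide 0<B 0<θ
        M , q = cy δ 0<δ
        N , p = cx η 0<η
    in (K ⊔ L) ⊔ (M ⊔ N) , λ m n m≥ n≥ →
      let KL≤m = ℕ.m⊔n≤o⇒m≤o (K ⊔ L) (M ⊔ N) m≥
          KL≤n = ℕ.m⊔n≤o⇒m≤o (K ⊔ L) (M ⊔ N) n≥
          MN≤m = ℕ.m⊔n≤o⇒n≤o (K ⊔ L) (M ⊔ N) m≥
          MN≤n = ℕ.m⊔n≤o⇒n≤o (K ⊔ L) (M ⊔ N) n≥
      in ℚ.≤-<-trans
           (*-close {x m} {y m} {x n} {y n} {A} {B} {δ} {η} {θ} 0<δ 0<η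
              (x≤A m (ℕ.m⊔n≤o⇒m≤o K L KL≤m))
              (y≤B n (ℕ.m⊔n≤o⇒n≤o K L KL≤n))
              (q m n (ℕ.m⊔n≤o⇒m≤o M N MN≤m) (ℕ.m⊔n≤o⇒m≤o M N MN≤n))
              (p m n (ℕ.m⊔n≤o⇒n≤o M N MN≤m) (ℕ.m⊔n≤o⇒n≤o M N MN≤n))
              Aδ≡θ Bη≡θ)
           2θ<ε

  *-cauchy : ∀ x y → IsCauchy x → IsCauchy y →
             IsCauchy (λ n → x n ℚ.* y n)
  *-cauchy x y cx cy ε 0<ε =
    *-cauchy′ {x} {y} {½ ℚ.* (½ ℚ.* ε)} cx cy (0<½ε (0<½ε 0<ε))
      (subst (ℚ._< ε) (sym (halves (½ ℚ.* ε))) (half< 0<ε))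

private
  open CauchyProperties using (+-cauchy; neg-cauchy; *-cauchy)

infix  8 -_
infixl 7 _*_
infixl 6 _+_ _-_

fromℚ : ℚ → ℝ
fromℚ q = mkℝ (λ _ → q) λ ε 0<ε →
  0 , λ _ _ _ _ → subst (λ d → ℚ.∣ d ∣ ℚ.< ε) (sym (ℚ.+-inverseʳ q)) 0<ε

0ℝ 1ℝ : ℝ
0ℝ = fromℚ 0ℚ
1ℝ = fromℚ 1ℚ

_+_ : ℝ → ℝ → ℝ
x + y = mkℝ (λ n → seq x n ℚ.+ seq y n) (+-cauchy (seq x) (seq y) (cauchy x) (cauchy y))

-_ : ℝ → ℝ
- x = mkℝ (λ n → ℚ.- seq x n) (neg-cauchy (seq x) (cauchy x))

_-_ : ℝ → ℝ → ℝ
x - y = x + (- y)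

_*_ : ℝ → ℝ → ℝ
x * y = mkℝ (λ n → seq x n ℚ.* seq y n) (*-cauchy (seq x) (seq y) (cauchy x) (cauchy y))

UnitInterval : ℝ → Set
UnitInterval p = 0ℝ ≤ p × p ≤ 1ℝ

-- b = sup_{p ∈ [0,1]} f p, as least upper bound.
IsSupOnUnitInterval : (ℝ → ℝ) → ℝ → Set
IsSupOnUnitInterval f b =
  (∀ p → UnitInterval p → f p ≤ b) ×
  (∀ u → (∀ p → UnitInterval p → f p ≤ u) → b ≤ u)

data ℝ∞ : Set where
  fin : ℝ → ℝ∞
  ∞   : ℝ∞

-- IsRatio b g r: r is the value of b / g, which is +∞ when g is zero.
-- A relation, because equality of reals with zero is not decidable.
IsRatio : ℝ → ℝ → ℝ∞ → Set
IsRatio b g (fin r) = ¬ (g ≈ 0ℝ) × r * g ≈ b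
IsRatio b g ∞       = g ≈ 0ℝ

-- Distance to the real number l less than ε.
Near : ℝ → ℝ → ℝ∞ → Set
Near l ε (fin r) = l - ε < r × r < l + ε
Near l ε ∞       = ⊥

ConvergesTo : (ℕ → ℝ∞) → ℝ → Set
ConvergesTo ρ l = ∀ ε → 0ℝ < ε → Eventually λ t → Near l ε (ρ t)

------------------------------------------------------------------------
-- Symmetric distributions on {-1,1}^k.  The stdlib type Sign, with its
-- multiplication, is {-1,1}.

Cube : ℕ → Set
Cube k = Vec Sign k

_⊙_ : ∀ {k} → Cube k → Cube k → Cube k
_⊙_ = zipWith Sign._*_

weight : ∀ {k} → Cube k → ℕ
weight = count (Sign._≟ Sign.+)

∑ : ∀ {k} → (Cube k → ℝ) → ℝ
∑ {zero}  f = f []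
∑ {suc k} f = ∑ (λ x → f (Sign.+ ∷ x)) + ∑ (λ x → f (Sign.- ∷ x))

record Δ (k : ℕ) : Set where
  field
    prob      : Cube k → ℝ
    nonneg    : ∀ x → 0ℝ ≤ prob x
    total     : ∑ prob ≈ 1ℝ
    symmetric : ∀ x y → weight x ≡ weight y → prob x ≈ prob y

open Δ public

𝔼 : ∀ {k} → (Cube k → ℝ) → (Cube k → ℝ) → ℝ
𝔼 P f = ∑ (λ x → P x * f x)

signValue : Sign → ℝ
signValue Sign.+ = 1ℝ
signValue Sign.- = - 1ℝ

μ : ∀ {k} → Δ (suc k) → ℝ
μ D = 𝔼 (prob D) (λ b → signValue (head b))

Bern : ℝ → Sign → ℝ
Bern p Sign.+ = p
Bern p Sign.- = 1ℝ - p

Bern^ : ∀ {k} → ℝ → Cube k → ℝ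
Bern^ p []      = 1ℝ
Bern^ p (s ∷ b) = Bern p s * Bern^ p b

-- A set S of Hamming weights is given as the list of its elements.
indicator : ∀ {k} → List ℕ → Cube k → ℝ
indicator S x with _∈?_ ℕ._≟_ (weight x) S
... | yes _ = 1ℝ
... | no  _ = 0ℝ

lam : ∀ {k} → List ℕ → Δ k → ℝ → ℝ
lam S D p = 𝔼 (prob D) (λ a → 𝔼 (Bern^ p) (λ b → indicator S (a ⊙ b)))

IsBeta : ∀ {k} → List ℕ → Δ k → ℝ → Set
IsBeta S D = IsSupOnUnitInterval (lam S D)

γ : ∀ {k} → List ℕ → Δ k → ℝ
γ S D = lam S D 1ℝ

-- r = β_S(D_N) / γ_S(D_Y)
IsBetaGammaRatio : ∀ {k} → List ℕ → Δ k × Δ k → ℝ∞ → Set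
IsBetaGammaRatio S (DY , DN) r = ∃[ b ] (IsBeta S DN b × IsRatio b (γ S DY) r)

IsMixture : ∀ {k} → ℝ → Δ k → Δ k → Δ k → Set
IsMixture τ D₀ D′ D =
  ∀ x → prob D x ≈ τ * prob D₀ x + (1ℝ - τ) * prob D′ x

PaddedOneWisePair : ∀ {k} → Δ (suc k) × Δ (suc k) → Set
PaddedOneWisePair {k} (DY , DN) =
  ∃[ τ ] ∃[ D₀ ] ∃[ DY′ ] ∃[ DN′ ]
    ( UnitInterval τ
    × μ {k} DY′ ≈ 0ℝ
    × μ {k} DN′ ≈ 0ℝ
    × IsMixture τ D₀ DY′ DY
    × IsMixture τ D₀ DN′ DN )

{-# OPTIONS --safe #-}
module Submission where

open import Defs
open import Data.Integer using (+_)
open import Data.List using ([_])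
open import Data.Nat using (ℕ; zero; suc; _⊔_)
import Data.Nat.Properties as ℕ
open import Data.Product using (_×_; _,_; ∃-syntax; Σ-syntax)
open import Data.Rational as ℚ using (ℚ; 0ℚ; 1ℚ; ½; _/_)
import Data.Rational.Properties as ℚ
open import Data.Rational.Solver using (module +-*-Solver)
open import Data.Sign using (Sign)
open import Data.Sum using (inj₁; inj₂)
open import Data.Vec using ([]; _∷_; head)
open import Function using (_∘_)
open import Level using (0ℓ)
open import Relation.Binary.Bundles using (Preorder)
import Relation.Binary.Reasoning.Preorder as PreorderReasoning
open import Relation.Binary.PropositionalEquality
  using (_≡_; refl; sym; trans; cong; subst; subst₂)
open import Relation.Nullary using (¬_)
open import Relation.Nullary.Decidable using (from-yes)

open CauchyProperties using (0<½ε; halves; half<; bounded; divide; ∣*∣-mono; *-close)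

-- Of a padded pair, D_N must succeed already at p = 5/8:
--   λ(D_N, 5/8) ≥ 15/64 γ(D_Y),  and 15/64 > 2/9.
-- Both sides are linear in the decomposition, so it suffices to treat the
-- common part, where p³ = 125/512 ≥ 15/64, and the mean-zero parts, where
-- λ(D′_N, 5/8) ≥ 15/128 and γ(D′_Y) ≤ 1/2.  If u₀, …, u₃ are the
-- probabilities of a single point of each weight, then
--   λ(D, 5/8) = 15/128 + 45/512 μ(D) + 3/128 u₀ + 5/128 u₃,
--   1/2 + 1/2 μ(D) = u₃ + u₁ + 2 u₂.

-- Eventual properties and inequalities between rationals.

Eventually-map₂ : ∀ {P Q R : ℕ → Set} → (∀ n → P n → Q n → R n) →
                  Eventually P → Eventually Q → Eventually R
Eventually-map₂ f (M , p) (N , q) = M ⊔ N , λ n n≥ →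
  f n (p n (ℕ.m⊔n≤o⇒m≤o M N n≥)) (q n (ℕ.m⊔n≤o⇒n≤o M N n≥))

Eventually-map : ∀ {P R : ℕ → Set} → (∀ n → P n → R n) → Eventually P → Eventually R
Eventually-map f (M , p) = M , λ n n≥ → f n (p n n≥)

∣p∣<ε : ∀ {p ε} → p ℚ.< ε → ℚ.- p ℚ.< ε → ℚ.∣ p ∣ ℚ.< ε
∣p∣<ε {p} {ε} p<ε -p<ε with ℚ.∣p∣≡p∨∣p∣≡-p p
... | inj₁ eq = subst (ℚ._< ε) (sym eq) p<ε
... | inj₂ eq = subst (ℚ._< ε) (sym eq) -p<ε

p≤∣p∣ : ∀ p → p ℚ.≤ ℚ.∣ p ∣
p≤∣p∣ p with ℚ.≤-total 0ℚ p
... | inj₁ 0≤p = ℚ.≤-reflexive (sym (ℚ.0≤p⇒∣p∣≡p 0≤p))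
... | inj₂ p≤0 = ℚ.≤-trans p≤0 (ℚ.0≤∣p∣ p)

∣p-q∣≡∣q-p∣ : ∀ p q → ℚ.∣ p ℚ.- q ∣ ≡ ℚ.∣ q ℚ.- p ∣
∣p-q∣≡∣q-p∣ p q = trans (cong ℚ.∣_∣ (solve 2 (λ p q → p :- q := :- (q :- p)) refl p q))
                        (ℚ.∣-p∣≡∣p∣ (q ℚ.- p))
  where open +-*-Solver

p<q+ε⇒p-q<ε : ∀ {p q ε} → p ℚ.< q ℚ.+ ε → p ℚ.- q ℚ.< ε
p<q+ε⇒p-q<ε {p} {q} {ε} p<q+ε =
  subst (p ℚ.- q ℚ.<_) (solve 2 (λ q ε → q :+ ε :- q := ε) refl q ε)
        (ℚ.+-monoˡ-< (ℚ.- q) p<q+ε)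
  where open +-*-Solver

p-q<ε⇒p<q+ε : ∀ {p q ε} → p ℚ.- q ℚ.< ε → p ℚ.< q ℚ.+ ε
p-q<ε⇒p<q+ε {p} {q} {ε} p-q<ε =
  subst (ℚ._< q ℚ.+ ε) (solve 2 (λ p q → q :+ (p :- q) := p) refl p q)
        (ℚ.+-monoʳ-< q p-q<ε)
  where open +-*-Solver

p<p+ε : ∀ {p ε} → 0ℚ ℚ.< ε → p ℚ.< p ℚ.+ ε
p<p+ε {p} {ε} 0<ε = subst (ℚ._< p ℚ.+ ε) (ℚ.+-identityʳ p) (ℚ.+-monoʳ-< p 0<ε)

∣p∣<ε⇒0<p+ε : ∀ {p ε} → ℚ.∣ p ∣ ℚ.< ε → 0ℚ ℚ.< p ℚ.+ ε
∣p∣<ε⇒0<p+ε {p} {ε} ∣p∣<ε =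
  p-q<ε⇒p<q+ε {0ℚ} {p} (subst (ℚ._< ε) (sym (ℚ.+-identityˡ (ℚ.- p)))
    (ℚ.≤-<-trans (p≤∣p∣ (ℚ.- p)) (subst (ℚ._< ε) (sym (ℚ.∣-p∣≡∣p∣ p)) ∣p∣<ε)))

-- A real that is nonnegative only in the limit may have negative terms; such terms lie within the
-- tolerance of zero.
0<p+ε∧p≤0⇒∣p∣<ε : ∀ {p ε} → 0ℚ ℚ.< p ℚ.+ ε → p ℚ.≤ 0ℚ → ℚ.∣ p ∣ ℚ.< ε
0<p+ε∧p≤0⇒∣p∣<ε {p} {ε} 0<p+ε p≤0 =
  ∣p∣<ε (ℚ.≤-<-trans p≤0 (ℚ.≤-<-trans (ℚ.neg-antimono-≤ p≤0) -p<ε)) -p<ε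
  where
  -p<ε : ℚ.- p ℚ.< ε
  -p<ε = subst (ℚ._< ε) (ℚ.+-identityˡ (ℚ.- p)) (p<q+ε⇒p-q<ε {0ℚ} {p} 0<p+ε)

-- Equality and order of reals.

-- The relations on reals only look at the sequences.  Stating them on
-- sequences keeps Agda from comparing Cauchy proofs, and the record
-- wrappers let it infer the sequences.

infix 4 _~_ _≲_ _≋_ _≼_

record _~_ (s t : ℕ → ℚ) : Set where
  constructor mk~
  field close : ∀ ε → 0ℚ ℚ.< ε → Eventually λ n → ℚ.∣ s n ℚ.- t n ∣ ℚ.< ε

record _≲_ (s t : ℕ → ℚ) : Set where
  constructor mk≲
  field below : ∀ ε → 0ℚ ℚ.< ε → Eventually λ n → s n ℚ.< t n ℚ.+ ε

open _~_
open _≲_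

_≋_ _≼_ : ℝ → ℝ → Set
x ≋ y = seq x ~ seq y
x ≼ y = seq x ≲ seq y

pointwise : ∀ {s t} → (∀ n → s n ≡ t n) → s ~ t
pointwise {s} {t} s≡t = mk~ λ ε 0<ε → 0 , λ n _ →
  subst (ℚ._< ε) (sym (trans (cong (λ q → ℚ.∣ q ℚ.- t n ∣) (s≡t n))
                             (cong ℚ.∣_∣ (ℚ.+-inverseʳ (t n))))) 0<ε

~-refl : ∀ {s} → s ~ s
~-refl = pointwise λ _ → refl

~-sym : ∀ {s t} → s ~ t → t ~ s
~-sym {s} {t} (mk~ s≈t) = mk~ λ ε 0<ε →
  Eventually-map (λ n → subst (ℚ._< ε) (∣p-q∣≡∣q-p∣ (s n) (t n))) (s≈t ε 0<ε)

~⇒≲ : ∀ {s t} → s ~ t → s ≲ t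
~⇒≲ {s} {t} (mk~ s≈t) = mk≲ λ ε 0<ε → Eventually-map
  (λ n ∣s-t∣<ε → p-q<ε⇒p<q+ε {s n} {t n} (ℚ.≤-<-trans (p≤∣p∣ _) ∣s-t∣<ε)) (s≈t ε 0<ε)

≲-antisym : ∀ {s t} → s ≲ t → t ≲ s → s ~ t
≲-antisym {s} {t} (mk≲ s≤t) (mk≲ t≤s) = mk~ λ ε 0<ε → Eventually-map₂
  (λ n s<t+ε t<s+ε → ∣p∣<ε (p<q+ε⇒p-q<ε {s n} {t n} s<t+ε)
    (subst (ℚ._< ε) (solve 2 (λ s t → t :- s := :- (s :- t)) refl (s n) (t n))
      (p<q+ε⇒p-q<ε {t n} {s n} t<s+ε)))
  (s≤t ε 0<ε) (t≤s ε 0<ε)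
  where open +-*-Solver

≲-trans : ∀ {s t r} → s ≲ t → t ≲ r → s ≲ r
≲-trans {s} {t} {r} (mk≲ s≤t) (mk≲ t≤r) = mk≲ λ ε 0<ε → Eventually-map₂
  (λ n s<t+½ε t<r+½ε → ℚ.<-trans s<t+½ε
    (subst (t n ℚ.+ ½ ℚ.* ε ℚ.<_)
      (trans (ℚ.+-assoc (r n) (½ ℚ.* ε) (½ ℚ.* ε)) (cong (r n ℚ.+_) (halves ε)))
      (ℚ.+-monoˡ-< (½ ℚ.* ε) t<r+½ε)))
  (s≤t (½ ℚ.* ε) (0<½ε 0<ε)) (t≤r (½ ℚ.* ε) (0<½ε 0<ε))

-- Equality is the order in both directions, so the splitting of `ε` in `≲-trans` serves here too.
~-trans : ∀ {s t r} → s ~ t → t ~ r → s ~ r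
~-trans s~t t~r = ≲-antisym (≲-trans (~⇒≲ s~t) (~⇒≲ t~r))
                            (≲-trans (~⇒≲ (~-sym t~r)) (~⇒≲ (~-sym s~t)))

≼-preorder : Preorder 0ℓ 0ℓ 0ℓ
≼-preorder = record
  { Carrier = ℝ
  ; _≈_ = _≋_
  ; _≲_ = _≼_
  ; isPreorder = record
    { isEquivalence = record { refl = ~-refl ; sym = ~-sym ; trans = ~-trans }
    ; reflexive = ~⇒≲
    ; trans = ≲-trans
    }
  }

module ≼-Reasoning = PreorderReasoning ≼-preorder

<⇒≼ : ∀ x y → x < y → x ≼ y
<⇒≼ x y (δ , 0<δ , x+δ<y) = mk≲ λ ε 0<ε → Eventually-map
  (λ n x+δ<y → ℚ.<-trans (p<p+ε {seq x n} 0<δ) (ℚ.<-trans x+δ<y (p<p+ε {seq y n} 0<ε))) x+δ<y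

fromℚ-mono-≼ : ∀ {p q} → p ℚ.≤ q → fromℚ p ≼ fromℚ q
fromℚ-mono-≼ {p} {q} p≤q = mk≲ λ ε 0<ε → 0 , λ n _ → ℚ.≤-<-trans p≤q (p<p+ε {q} 0<ε)

-- Compatibility of the ring operations with equality and order.

+-mono-≼ : ∀ x y z w → x ≼ y → z ≼ w → x + z ≼ y + w
+-mono-≼ x y z w (mk≲ x≤y) (mk≲ z≤w) = mk≲ λ ε 0<ε → Eventually-map₂
  (λ n x<y+½ε z<w+½ε → subst (seq x n ℚ.+ seq z n ℚ.<_)
    (trans (solve 3 (λ y w e → (y :+ e) :+ (w :+ e) := (y :+ w) :+ (e :+ e)) refl
              (seq y n) (seq w n) (½ ℚ.* ε))
           (cong (seq y n ℚ.+ seq w n ℚ.+_) (halves ε)))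
    (ℚ.+-mono-< x<y+½ε z<w+½ε))
  (x≤y (½ ℚ.* ε) (0<½ε 0<ε)) (z≤w (½ ℚ.* ε) (0<½ε 0<ε))
  where open +-*-Solver

+-cong : ∀ x y z w → x ≋ y → z ≋ w → x + z ≋ y + w
+-cong x y z w x≋y z≋w =
  ≲-antisym (+-mono-≼ x y z w (~⇒≲ x≋y) (~⇒≲ z≋w))
            (+-mono-≼ y x w z (~⇒≲ (~-sym x≋y)) (~⇒≲ (~-sym z≋w)))

-- The difference is `x * (z - w) + w * (x - y)`, where `x` and `w` are eventually bounded and the
-- other two factors become small.
*-cong : ∀ x y z w → x ≋ y → z ≋ w → x * z ≋ y * w
*-cong x y z w (mk~ x≈y) (mk~ z≈w) = mk~ λ ε 0<ε →
  let A , 0<A , x≤A = bounded (seq x) (cauchy x)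
      B , 0<B , w≤B = bounded (seq w) (cauchy w)
      -- A quarter of `ε`: `*-close` yields only a non-strict bound by `θ + θ`, which is half of `ε`
      -- and hence strictly below it.
      θ = ½ ℚ.* (½ ℚ.* ε)
      0<θ = 0<½ε (0<½ε 0<ε)
      δ , 0<δ , Aδ≡θ = divide 0<A 0<θ
      η , 0<η , Bη≡θ = divide 0<B 0<θ
  in Eventually-map₂
       (λ { n (∣x∣≤A , ∣w∣≤B) (x-y<η , z-w<δ) → ℚ.≤-<-trans
              (*-close {seq x n} {seq z n} {seq y n} {seq w n} {A} {B} {δ} {η} {θ}
                 0<δ 0<η ∣x∣≤A ∣w∣≤B z-w<δ x-y<η Aδ≡θ Bη≡θ)
              (subst (ℚ._< ε) (sym (halves (½ ℚ.* ε))) (half< 0<ε)) })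
       (Eventually-map₂ (λ _ → _,_) x≤A w≤B)
       (Eventually-map₂ (λ _ → _,_) (x≈y η 0<η) (z≈w δ 0<δ))

*-congˡ : ∀ x y z → y ≋ z → x * y ≋ x * z
*-congˡ x y z = *-cong x x y z ~-refl

*-congʳ : ∀ x y z → y ≋ z → y * x ≋ z * x
*-congʳ x y z y≋z = *-cong y z x x y≋z ~-refl

-- If both factors are nonnegative, so is the product. Otherwise a nonpositive factor is smaller in
-- absolute value than its tolerance, and the bound on the other factor keeps the product within `θ`
-- of zero.
0<pq+ε : ∀ {p q ε A B δ η θ} → 0ℚ ℚ.< ε → θ ℚ.< ε → 0ℚ ℚ.< η → 0ℚ ℚ.< δ →
         ℚ.∣ p ∣ ℚ.≤ A → ℚ.∣ q ∣ ℚ.≤ B → 0ℚ ℚ.< p ℚ.+ η → 0ℚ ℚ.< q ℚ.+ δ →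
         A ℚ.* δ ≡ θ → B ℚ.* η ≡ θ → 0ℚ ℚ.< p ℚ.* q ℚ.+ ε
0<pq+ε {p} {q} {ε} {A} {B} {δ} {η} {θ} 0<ε θ<ε 0<η 0<δ ∣p∣≤A ∣q∣≤B 0<p+η 0<q+δ Aδ≡θ Bη≡θ
  with ℚ.≤-total 0ℚ p | ℚ.≤-total 0ℚ q
... | inj₁ 0≤p | inj₁ 0≤q = ℚ.≤-<-trans
  (subst (ℚ._≤ p ℚ.* q) (ℚ.*-zeroʳ p) (ℚ.*-monoˡ-≤-nonNeg p {{ℚ.nonNegative 0≤p}} 0≤q))
  (p<p+ε {p ℚ.* q} 0<ε)
... | _ | inj₂ q≤0 = ∣p∣<ε⇒0<p+ε {p ℚ.* q} (ℚ.≤-<-trans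
  (subst (ℚ.∣ p ℚ.* q ∣ ℚ.≤_) Aδ≡θ
    (∣*∣-mono {p} {q} {A} {δ} 0<δ ∣p∣≤A (0<p+ε∧p≤0⇒∣p∣<ε {q} 0<q+δ q≤0)))
  θ<ε)
... | inj₂ p≤0 | _ = ∣p∣<ε⇒0<p+ε {p ℚ.* q} (ℚ.≤-<-trans
  (subst₂ (λ r s → ℚ.∣ r ∣ ℚ.≤ s) (ℚ.*-comm q p) Bη≡θ
    (∣*∣-mono {q} {p} {B} {η} 0<η ∣q∣≤B (0<p+ε∧p≤0⇒∣p∣<ε {p} 0<p+η p≤0)))
  θ<ε)

*-nonneg : ∀ x y → 0ℝ ≼ x → 0ℝ ≼ y → 0ℝ ≼ x * y
*-nonneg x y (mk≲ 0≤x) (mk≲ 0≤y) = mk≲ λ ε 0<ε → near0 {ε} 0<ε (half< 0<ε) (0<½ε 0<ε)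
  where
  near0 : ∀ {ε θ} → 0ℚ ℚ.< ε → θ ℚ.< ε → 0ℚ ℚ.< θ →
          Eventually λ n → 0ℚ ℚ.< seq x n ℚ.* seq y n ℚ.+ ε
  near0 {ε} {θ} 0<ε θ<ε 0<θ =
    let A , 0<A , x≤A = bounded (seq x) (cauchy x)
        B , 0<B , y≤B = bounded (seq y) (cauchy y)
        δ , 0<δ , Aδ≡θ = divide 0<A 0<θ
        η , 0<η , Bη≡θ = divide 0<B 0<θ
    in Eventually-map₂
         (λ { n (∣x∣≤A , ∣y∣≤B) (0<x+η , 0<y+δ) →
                0<pq+ε {seq x n} {seq y n} {ε} {A} {B} {δ} {η} {θ}
                  0<ε θ<ε 0<η 0<δ ∣x∣≤A ∣y∣≤B 0<x+η 0<y+δ Aδ≡θ Bη≡θ })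
         (Eventually-map₂ (λ _ → _,_) x≤A y≤B)
         (Eventually-map₂ (λ _ → _,_) (0≤x η 0<η) (0≤y δ 0<δ))

-- Reduces an inequality to an explicit nonnegative slack and an equation, which the ring solver can
-- then check termwise.
≼-slack : ∀ x y s → 0ℝ ≼ s → x + s ≋ y → x ≼ y
≼-slack x y s 0≼s x+s≋y = begin
  x       ≈⟨ pointwise (λ n → sym (ℚ.+-identityʳ (seq x n))) ⟩
  x + 0ℝ  ≲⟨ +-mono-≼ x x 0ℝ s (~⇒≲ ~-refl) 0≼s ⟩
  x + s   ≈⟨ x+s≋y ⟩
  y       ∎
  where open ≼-Reasoning

+-nonneg : ∀ x y → 0ℝ ≼ x → 0ℝ ≼ y → 0ℝ ≼ x + y
+-nonneg x y 0≼x 0≼y = ≲-trans (~⇒≲ (pointwise λ _ → refl)) (+-mono-≼ 0ℝ x 0ℝ y 0≼x 0≼y)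

≼⇒0≼- : ∀ x y → x ≼ y → 0ℝ ≼ y - x
≼⇒0≼- x y x≼y = begin
  0ℝ     ≈⟨ pointwise (λ n → sym (ℚ.+-inverseʳ (seq x n))) ⟩
  x - x  ≲⟨ +-mono-≼ x y (- x) (- x) x≼y (~⇒≲ ~-refl) ⟩
  y - x  ∎
  where open ≼-Reasoning

*-monoˡ-≼ : ∀ x y z → 0ℝ ≼ x → y ≼ z → x * y ≼ x * z
*-monoˡ-≼ x y z 0≼x y≼z = ≼-slack (x * y) (x * z) (x * (z - y)) (*-nonneg x (z - y) 0≼x (≼⇒0≼- y z y≼z))
  (pointwise λ n → solve 3 (λ x y z → x :* y :+ x :* (z :- y) := x :* z) refl
                     (seq x n) (seq y n) (seq z n))
  where open +-*-Solver

*-comm : ∀ x y → x * y ≋ y * x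
*-comm x y = pointwise λ n → ℚ.*-comm (seq x n) (seq y n)

*-monoʳ-≼ : ∀ x y z → 0ℝ ≼ x → y ≼ z → y * x ≼ z * x
*-monoʳ-≼ x y z 0≼x y≼z =
  ≲-trans (~⇒≲ (*-comm y x)) (≲-trans (*-monoˡ-≼ x y z 0≼x y≼z) (~⇒≲ (*-comm x z)))

*-fromℚ-nonneg : ∀ x q → .{{ℚ.NonNegative q}} → 0ℝ ≼ x → 0ℝ ≼ fromℚ q * x
*-fromℚ-nonneg x q = *-nonneg (fromℚ q) x (fromℚ-mono-≼ (ℚ.nonNegative⁻¹ q))

-- Sums over the cube

∑-cong : ∀ {k} (f g : Cube k → ℝ) → (∀ x → f x ≋ g x) → ∑ f ≋ ∑ g
∑-cong {zero}  f g f≋g = f≋g []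
∑-cong {suc k} f g f≋g =
  +-cong (∑ (f ∘ (Sign.+ ∷_))) (∑ (g ∘ (Sign.+ ∷_))) (∑ (f ∘ (Sign.- ∷_))) (∑ (g ∘ (Sign.- ∷_)))
    (∑-cong (f ∘ (Sign.+ ∷_)) (g ∘ (Sign.+ ∷_)) (f≋g ∘ (Sign.+ ∷_)))
    (∑-cong (f ∘ (Sign.- ∷_)) (g ∘ (Sign.- ∷_)) (f≋g ∘ (Sign.- ∷_)))

+-*-interchange : ∀ a b s t u v → (a * s + b * t) + (a * u + b * v) ≋ a * (s + u) + b * (t + v)
+-*-interchange a b s t u v = pointwise λ n → solve 6
  (λ a b s t u v → (a :* s :+ b :* t) :+ (a :* u :+ b :* v) := a :* (s :+ u) :+ b :* (t :+ v))
  refl (seq a n) (seq b n) (seq s n) (seq t n) (seq u n) (seq v n)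
  where open +-*-Solver

∑-linear : ∀ {k} a b (f g : Cube k → ℝ) → ∑ (λ x → a * f x + b * g x) ≋ a * ∑ f + b * ∑ g
∑-linear {zero}  a b f g = pointwise λ n → refl
∑-linear {suc k} a b f g = ~-trans
  (+-cong (∑ λ x → a * f (Sign.+ ∷ x) + b * g (Sign.+ ∷ x))
          (a * ∑ (λ x → f (Sign.+ ∷ x)) + b * ∑ (λ x → g (Sign.+ ∷ x)))
          (∑ λ x → a * f (Sign.- ∷ x) + b * g (Sign.- ∷ x))
          (a * ∑ (λ x → f (Sign.- ∷ x)) + b * ∑ (λ x → g (Sign.- ∷ x)))
          (∑-linear a b (λ x → f (Sign.+ ∷ x)) (λ x → g (Sign.+ ∷ x)))
          (∑-linear a b (λ x → f (Sign.- ∷ x)) (λ x → g (Sign.- ∷ x))))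
  (+-*-interchange a b (∑ λ x → f (Sign.+ ∷ x)) (∑ λ x → g (Sign.+ ∷ x))
                       (∑ λ x → f (Sign.- ∷ x)) (∑ λ x → g (Sign.- ∷ x)))

𝔼-congˡ : ∀ {k} (P Q f : Cube k → ℝ) → (∀ x → P x ≋ Q x) → 𝔼 P f ≋ 𝔼 Q f
𝔼-congˡ P Q f P≋Q =
  ∑-cong (λ x → P x * f x) (λ x → Q x * f x) λ x → *-congʳ (f x) (P x) (Q x) (P≋Q x)

𝔼-congʳ : ∀ {k} (P f g : Cube k → ℝ) → (∀ x → f x ≋ g x) → 𝔼 P f ≋ 𝔼 P g
𝔼-congʳ P f g f≋g =
  ∑-cong (λ x → P x * f x) (λ x → P x * g x) λ x → *-congˡ (P x) (f x) (g x) (f≋g x)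

𝔼-linear : ∀ {k} a b (P Q f : Cube k → ℝ) →
           𝔼 (λ x → a * P x + b * Q x) f ≋ a * 𝔼 P f + b * 𝔼 Q f
𝔼-linear a b P Q f = ~-trans
  (∑-cong (λ x → (a * P x + b * Q x) * f x) (λ x → a * (P x * f x) + b * (Q x * f x))
    λ x → pointwise λ n → solve 5
      (λ a b p q f → (a :* p :+ b :* q) :* f := a :* (p :* f) :+ b :* (q :* f))
      refl (seq a n) (seq b n) (seq (P x) n) (seq (Q x) n) (seq (f x) n))
  (∑-linear a b (λ x → P x * f x) (λ x → Q x * f x))
  where open +-*-Solver

𝔼-zero : ∀ {k} (P : Cube k → ℝ) → 𝔼 P (λ _ → 0ℝ) ≋ 0ℝ
𝔼-zero {zero}  P = pointwise λ n → ℚ.*-zeroʳ (seq (P []) n)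
𝔼-zero {suc k} P = ~-trans
  (+-cong (𝔼 (λ x → P (Sign.+ ∷ x)) (λ _ → 0ℝ)) 0ℝ (𝔼 (λ x → P (Sign.- ∷ x)) (λ _ → 0ℝ)) 0ℝ
          (𝔼-zero λ x → P (Sign.+ ∷ x)) (𝔼-zero λ x → P (Sign.- ∷ x)))
  (pointwise λ n → refl)

𝔼-scale : ∀ {k} a (P f : Cube k → ℝ) → 𝔼 (λ x → a * P x) f ≋ a * 𝔼 P f
𝔼-scale a P f = ~-trans
  -- A second summand with coefficient zero makes scaling a case of `∑-linear`.
  (∑-cong (λ x → (a * P x) * f x) (λ x → a * (P x * f x) + 0ℝ * (P x * f x))
    λ x → pointwise λ n → solve 3
      (λ a p f → (a :* p) :* f := a :* (p :* f) :+ con 0ℚ :* (p :* f))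
      refl (seq a n) (seq (P x) n) (seq (f x) n))
  (~-trans (∑-linear a 0ℝ (λ x → P x * f x) (λ x → P x * f x))
    (pointwise λ n → solve 2 (λ a s → a :* s :+ con 0ℚ :* s := a :* s) refl
                       (seq a n) (seq (𝔼 P f) n)))
  where open +-*-Solver

𝔼-mixture : ∀ {k} a b (P Q R f : Cube k → ℝ) → (∀ x → R x ≋ a * P x + b * Q x) →
            𝔼 R f ≋ a * 𝔼 P f + b * 𝔼 Q f
𝔼-mixture a b P Q R f R≋ =
  ~-trans (𝔼-congˡ R (λ x → a * P x + b * Q x) f R≋) (𝔼-linear a b P Q f)

lam-mixture : ∀ {k} S (D₀ D′ D : Δ k) τ p → IsMixture τ D₀ D′ D →
              lam S D p ≋ τ * lam S D₀ p + (1ℝ - τ) * lam S D′ p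
lam-mixture S D₀ D′ D τ p mix =
  𝔼-mixture τ (1ℝ - τ) (prob D₀) (prob D′) (prob D)
    (λ a → 𝔼 (Bern^ p) (λ b → indicator S (a ⊙ b))) λ x → mk~ (mix x)

-- The AND function under Bernoulli noise.

-- AND by recursion on the vector. Unlike `indicator`, which decides membership of the whole weight,
-- it reduces one coordinate at a time, as `Bern^` and `∑` do.
allPlus : ∀ {k} → Cube k → ℝ
allPlus []           = 1ℝ
allPlus (Sign.+ ∷ x) = allPlus x
allPlus (Sign.- ∷ x) = 0ℝ

𝔼-cong : ∀ {k} (P Q f g : Cube k → ℝ) → (∀ x → P x ≋ Q x) → (∀ x → f x ≋ g x) → 𝔼 P f ≋ 𝔼 Q g
𝔼-cong P Q f g P≋Q f≋g = ~-trans (𝔼-congˡ P Q f P≋Q) (𝔼-congʳ Q f g f≋g)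

𝔼-vanish : ∀ {k} (P f : Cube k → ℝ) → (∀ x → f x ≋ 0ℝ) → 𝔼 P f ≋ 0ℝ
𝔼-vanish P f f≋0 = ~-trans (𝔼-congʳ P f (λ _ → 0ℝ) f≋0) (𝔼-zero P)

-- A product of two signs is plus exactly when they agree, so `a ⊙ b` is all plus only for `b` equal
-- to `a`; the expectation is the mass of that single point. In the induction only one value of the
-- first sign of `b` contributes.
𝔼-allPlus : ∀ {k} p (a : Cube k) → 𝔼 (Bern^ p) (λ b → allPlus (a ⊙ b)) ≋ Bern^ p a
𝔼-allPlus p []      = pointwise λ n → refl
𝔼-allPlus p (s ∷ a) = ~-trans
  (+-cong (𝔼 (λ b → Bern^ p (Sign.+ ∷ b)) (λ b → allPlus ((s ∷ a) ⊙ (Sign.+ ∷ b)))) (hit s Sign.+)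
          (𝔼 (λ b → Bern^ p (Sign.- ∷ b)) (λ b → allPlus ((s ∷ a) ⊙ (Sign.- ∷ b)))) (hit s Sign.-)
    (𝔼-head s Sign.+) (𝔼-head s Sign.-))
  (hit-total s)
  where
  -- The contribution of the vectors `b` with first sign `t`; the last clause covers the two cases
  -- of agreement.
  hit : Sign → Sign → ℝ
  hit Sign.+ Sign.- = 0ℝ
  hit Sign.- Sign.+ = 0ℝ
  hit s      t      = Bern p t * Bern^ p a

  hit-total : ∀ s → hit s Sign.+ + hit s Sign.- ≋ Bern^ p (s ∷ a)
  hit-total Sign.+ = pointwise λ n → ℚ.+-identityʳ (seq (p * Bern^ p a) n)
  hit-total Sign.- = pointwise λ n → ℚ.+-identityˡ (seq ((1ℝ - p) * Bern^ p a) n)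

  agree : ∀ s t → (∀ b → allPlus ((s ∷ a) ⊙ (t ∷ b)) ≋ allPlus (a ⊙ b)) →
          𝔼 (λ b → Bern^ p (t ∷ b)) (λ b → allPlus ((s ∷ a) ⊙ (t ∷ b))) ≋ Bern p t * Bern^ p a
  agree s t eq = ~-trans
    (𝔼-cong (λ b → Bern^ p (t ∷ b)) (λ b → Bern p t * Bern^ p b)
      (λ b → allPlus ((s ∷ a) ⊙ (t ∷ b))) (λ b → allPlus (a ⊙ b))
      (λ b → pointwise λ n → refl) eq)
    (~-trans (𝔼-scale (Bern p t) (Bern^ p) (λ b → allPlus (a ⊙ b)))
      (*-congˡ (Bern p t) (𝔼 (Bern^ p) (λ b → allPlus (a ⊙ b))) (Bern^ p a) (𝔼-allPlus p a)))

  𝔼-head : ∀ s t → 𝔼 (λ b → Bern^ p (t ∷ b)) (λ b → allPlus ((s ∷ a) ⊙ (t ∷ b))) ≋ hit s t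
  𝔼-head Sign.+ Sign.+ = agree Sign.+ Sign.+ λ b → pointwise λ n → refl
  𝔼-head Sign.+ Sign.- = 𝔼-vanish (λ b → Bern^ p (Sign.- ∷ b))
    (λ b → allPlus ((Sign.+ ∷ a) ⊙ (Sign.- ∷ b))) λ b → pointwise λ n → refl
  𝔼-head Sign.- Sign.+ = 𝔼-vanish (λ b → Bern^ p (Sign.+ ∷ b))
    (λ b → allPlus ((Sign.- ∷ a) ⊙ (Sign.+ ∷ b))) λ b → pointwise λ n → refl
  𝔼-head Sign.- Sign.- = agree Sign.- Sign.- λ b → pointwise λ n → refl

indicator≡allPlus : (x : Cube 3) → indicator [ 3 ] x ≡ allPlus x
indicator≡allPlus (Sign.+ ∷ Sign.+ ∷ Sign.+ ∷ []) = refl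
indicator≡allPlus (Sign.+ ∷ Sign.+ ∷ Sign.- ∷ []) = refl
indicator≡allPlus (Sign.+ ∷ Sign.- ∷ Sign.+ ∷ []) = refl
indicator≡allPlus (Sign.+ ∷ Sign.- ∷ Sign.- ∷ []) = refl
indicator≡allPlus (Sign.- ∷ Sign.+ ∷ Sign.+ ∷ []) = refl
indicator≡allPlus (Sign.- ∷ Sign.+ ∷ Sign.- ∷ []) = refl
indicator≡allPlus (Sign.- ∷ Sign.- ∷ Sign.+ ∷ []) = refl
indicator≡allPlus (Sign.- ∷ Sign.- ∷ Sign.- ∷ []) = refl

≡⇒≋ : ∀ {x y} → x ≡ y → x ≋ y
≡⇒≋ refl = ~-refl

-- With the noise summed out, a point with `j` plus signs is accepted with probability p^j
-- (1-p)^(3-j), so what remains is a single sum over the cube.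
lam≋𝔼Bern^ : ∀ (D : Δ 3) p → lam [ 3 ] D p ≋ 𝔼 (prob D) (Bern^ p)
lam≋𝔼Bern^ D p =
  𝔼-congʳ (prob D) (λ a → 𝔼 (Bern^ p) (λ b → indicator [ 3 ] (a ⊙ b))) (Bern^ p) λ a → ~-trans
    (𝔼-congʳ (Bern^ p) (λ b → indicator [ 3 ] (a ⊙ b)) (λ b → allPlus (a ⊙ b))
      λ b → ≡⇒≋ (indicator≡allPlus (a ⊙ b)))
    (𝔼-allPlus p a)

-- Symmetric distributions on the 3-cube

-- One representative per weight. The last clause serves weight 3 and makes the function total,
-- since no larger weight occurs on the 3-cube.
canonical : ℕ → Cube 3
canonical 0 = Sign.- ∷ Sign.- ∷ Sign.- ∷ []
canonical 1 = Sign.+ ∷ Sign.- ∷ Sign.- ∷ []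
canonical 2 = Sign.+ ∷ Sign.+ ∷ Sign.- ∷ []
canonical _ = Sign.+ ∷ Sign.+ ∷ Sign.+ ∷ []

weight-canonical : (x : Cube 3) → weight x ≡ weight (canonical (weight x))
weight-canonical (Sign.+ ∷ Sign.+ ∷ Sign.+ ∷ []) = refl
weight-canonical (Sign.+ ∷ Sign.+ ∷ Sign.- ∷ []) = refl
weight-canonical (Sign.+ ∷ Sign.- ∷ Sign.+ ∷ []) = refl
weight-canonical (Sign.+ ∷ Sign.- ∷ Sign.- ∷ []) = refl
weight-canonical (Sign.- ∷ Sign.+ ∷ Sign.+ ∷ []) = refl
weight-canonical (Sign.- ∷ Sign.+ ∷ Sign.- ∷ []) = refl
weight-canonical (Sign.- ∷ Sign.- ∷ Sign.+ ∷ []) = refl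
weight-canonical (Sign.- ∷ Sign.- ∷ Sign.- ∷ []) = refl

-- A mean-zero distribution split evenly between weights 1 and 2 has λ equal to p(1-p)/2, and γ of a
-- mean-zero distribution can be 1/2, which suggests the constant p(1-p), here 15/64. The common
-- part needs p³ ≥ p(1-p), that is p ≥ (√5-1)/2 ≈ 0.618; exceeding 2/9 needs 1/3 < p < 2/3. The
-- value 5/8 meets both conditions.
⅝ : ℝ
⅝ = fromℚ (+ 5 / 8)

module _ (D : Δ 3) where
  open +-*-Solver

  u : ℕ → ℝ
  u j = prob D (canonical j)

  u-nonneg : ∀ j → 0ℝ ≼ u j
  u-nonneg j = mk≲ (nonneg D (canonical j))

  prob≋u : ∀ x → prob D x ≋ u (weight x)
  prob≋u x = mk~ (symmetric D x (canonical (weight x)) (weight-canonical x))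

  total≋u : ∑ (prob D) ≋ u 0 + (u 1 + u 1 + u 1) + (u 2 + u 2 + u 2) + u 3
  total≋u = ~-trans (∑-cong (prob D) (λ x → u (weight x)) prob≋u) (pointwise λ n → solve 4
    -- The left side is the unfolded sum over the cube, plus before minus in each coordinate; `a`,
    -- `b`, `c`, `d` stand for `u 0` to `u 3`.
    (λ a b c d → ((d :+ c) :+ (c :+ b)) :+ ((c :+ b) :+ (b :+ a)) :=
      a :+ (b :+ b :+ b) :+ (c :+ c :+ c) :+ d) refl
      (seq (u 0) n) (seq (u 1) n) (seq (u 2) n) (seq (u 3) n))

  𝔼≋u : ∀ f → 𝔼 (prob D) f ≋ 𝔼 (λ x → u (weight x)) f
  𝔼≋u f = 𝔼-congˡ (prob D) (λ x → u (weight x)) f prob≋u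

  μ≋u : μ D ≋ (u 3 + u 2) - (u 1 + u 0)
  μ≋u = ~-trans (𝔼≋u λ b → signValue (head b)) (pointwise λ n → solve 4
    (λ a b c d →
      ((d :* con 1ℚ :+ c :* con 1ℚ) :+ (c :* con 1ℚ :+ b :* con 1ℚ)) :+
      ((c :* con (ℚ.- 1ℚ) :+ b :* con (ℚ.- 1ℚ)) :+ (b :* con (ℚ.- 1ℚ) :+ a :* con (ℚ.- 1ℚ))) :=
      (d :+ c) :- (b :+ a)) refl
      (seq (u 0) n) (seq (u 1) n) (seq (u 2) n) (seq (u 3) n))

  -- At p = 1 the noise is all plus almost surely, so only the all-plus vector is accepted.
  γ≋u : γ [ 3 ] D ≋ u 3
  γ≋u = ~-trans (lam≋𝔼Bern^ D 1ℝ) (~-trans (𝔼≋u (Bern^ 1ℝ)) (pointwise λ n → solve 4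
    (λ a b c d →
      ((d :* con 1ℚ :+ c :* con 0ℚ) :+ (c :* con 0ℚ :+ b :* con 0ℚ)) :+
      ((c :* con 0ℚ :+ b :* con 0ℚ) :+ (b :* con 0ℚ :+ a :* con 0ℚ)) := d) refl
      (seq (u 0) n) (seq (u 1) n) (seq (u 2) n) (seq (u 3) n)))

  lam⅝≋u : lam [ 3 ] D ⅝ ≋
    fromℚ (+ 27 / 512) * u 0 + fromℚ (+ 135 / 512) * u 1 +
    fromℚ (+ 225 / 512) * u 2 + fromℚ (+ 125 / 512) * u 3
  lam⅝≋u = ~-trans (lam≋𝔼Bern^ D ⅝) (~-trans (𝔼≋u (Bern^ ⅝)) (pointwise λ n → solve 4
    (λ a b c d →
      -- A point of weight `j` has coefficient 5^j 3^(3-j) / 512. Weights 1 and 2 occur three times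
      -- each, which gives 135 and 225.
      ((d :* con (+ 125 / 512) :+ c :* con (+ 75 / 512)) :+
       (c :* con (+ 75 / 512) :+ b :* con (+ 45 / 512))) :+
      ((c :* con (+ 75 / 512) :+ b :* con (+ 45 / 512)) :+
       (b :* con (+ 45 / 512) :+ a :* con (+ 27 / 512))) :=
      con (+ 27 / 512) :* a :+ con (+ 135 / 512) :* b :+
      con (+ 225 / 512) :* c :+ con (+ 125 / 512) :* d) refl
      (seq (u 0) n) (seq (u 1) n) (seq (u 2) n) (seq (u 3) n)))

  -- Coefficientwise: 15/64 = 120/512 is at most the coefficient 125/512 of `u 3`, and the other
  -- terms are nonnegative.
  15/64*u≼lam⅝ : fromℚ (+ 15 / 64) * u 3 ≼ lam [ 3 ] D ⅝
  15/64*u≼lam⅝ = ≼-slack (fromℚ (+ 15 / 64) * u 3) (lam [ 3 ] D ⅝) slack slack-nonneg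
    (~-trans (pointwise λ n → solve 4
      (λ a b c d → con (+ 15 / 64) :* d :+
        (con (+ 27 / 512) :* a :+ con (+ 135 / 512) :* b :+
         con (+ 225 / 512) :* c :+ con (+ 5 / 512) :* d) :=
        con (+ 27 / 512) :* a :+ con (+ 135 / 512) :* b :+
        con (+ 225 / 512) :* c :+ con (+ 125 / 512) :* d) refl
        (seq (u 0) n) (seq (u 1) n) (seq (u 2) n) (seq (u 3) n))
      (~-sym lam⅝≋u))
    where
    slack : ℝ
    slack = fromℚ (+ 27 / 512) * u 0 + fromℚ (+ 135 / 512) * u 1 +
            fromℚ (+ 225 / 512) * u 2 + fromℚ (+ 5 / 512) * u 3
    slack-nonneg : 0ℝ ≼ slack
    slack-nonneg =
      +-nonneg (fromℚ (+ 27 / 512) * u 0 + fromℚ (+ 135 / 512) * u 1 + fromℚ (+ 225 / 512) * u 2)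
               (fromℚ (+ 5 / 512) * u 3)
        (+-nonneg (fromℚ (+ 27 / 512) * u 0 + fromℚ (+ 135 / 512) * u 1) (fromℚ (+ 225 / 512) * u 2)
          (+-nonneg (fromℚ (+ 27 / 512) * u 0) (fromℚ (+ 135 / 512) * u 1)
            (*-fromℚ-nonneg (u 0) (+ 27 / 512) (u-nonneg 0))
            (*-fromℚ-nonneg (u 1) (+ 135 / 512) (u-nonneg 1)))
          (*-fromℚ-nonneg (u 2) (+ 225 / 512) (u-nonneg 2)))
        (*-fromℚ-nonneg (u 3) (+ 5 / 512) (u-nonneg 3))

  module _ (μ≈0 : μ D ≈ 0ℝ) where

    -- Linear-programming duality: `p` and `q` are multipliers for the constraints of total mass 1
    -- and mean 0. A linear form in the `u j` is bounded by comparing it with such a combination.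
    total*+μ* : ∀ p q →
      fromℚ p * (u 0 + (u 1 + u 1 + u 1) + (u 2 + u 2 + u 2) + u 3) +
      fromℚ q * ((u 3 + u 2) - (u 1 + u 0)) ≋ fromℚ p
    total*+μ* p q = ~-trans
      (+-cong (fromℚ p * total′) (fromℚ p * 1ℝ) (fromℚ q * μ′) (fromℚ q * 0ℝ)
        (*-congˡ (fromℚ p) total′ 1ℝ (~-trans (~-sym total≋u) (mk~ (total D))))
        (*-congˡ (fromℚ q) μ′ 0ℝ (~-trans (~-sym μ≋u) (mk~ μ≈0))))
      (pointwise λ n → solve 2 (λ p q → p :* con 1ℚ :+ q :* con 0ℚ := p) refl p q)
      where
      total′ μ′ : ℝ
      total′ = u 0 + (u 1 + u 1 + u 1) + (u 2 + u 2 + u 2) + u 3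
      μ′ = (u 3 + u 2) - (u 1 + u 0)

    -- The multipliers 15/128 and 45/512 are those that match the coefficients of `u 1` and `u 2`,
    -- where the minimum is attained; `u 0` and `u 3` are left with positive coefficients.
    15/128≼lam⅝ : fromℚ (+ 15 / 128) ≼ lam [ 3 ] D ⅝
    15/128≼lam⅝ = ≲-trans (~⇒≲ (~-sym (total*+μ* (+ 15 / 128) (+ 45 / 512))))
      (≼-slack
        (fromℚ (+ 15 / 128) * (u 0 + (u 1 + u 1 + u 1) + (u 2 + u 2 + u 2) + u 3) +
         fromℚ (+ 45 / 512) * ((u 3 + u 2) - (u 1 + u 0)))
        (lam [ 3 ] D ⅝)
        (fromℚ (+ 3 / 128) * u 0 + fromℚ (+ 5 / 128) * u 3)
        (+-nonneg (fromℚ (+ 3 / 128) * u 0) (fromℚ (+ 5 / 128) * u 3)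
          (*-fromℚ-nonneg (u 0) (+ 3 / 128) (u-nonneg 0))
          (*-fromℚ-nonneg (u 3) (+ 5 / 128) (u-nonneg 3)))
        (~-trans (pointwise λ n → solve 4
          (λ a b c d →
            con (+ 15 / 128) :* (a :+ (b :+ b :+ b) :+ (c :+ c :+ c) :+ d) :+
            con (+ 45 / 512) :* ((d :+ c) :- (b :+ a)) :+
            (con (+ 3 / 128) :* a :+ con (+ 5 / 128) :* d) :=
            con (+ 27 / 512) :* a :+ con (+ 135 / 512) :* b :+
            con (+ 225 / 512) :* c :+ con (+ 125 / 512) :* d) refl
            (seq (u 0) n) (seq (u 1) n) (seq (u 2) n) (seq (u 3) n))
          (~-sym lam⅝≋u)))

    -- With both multipliers ½ the term `u 0` cancels and `u 3` gets coefficient 1. Equality holds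
    -- for mass ½ on each of the two constant vectors.
    u≼½ : u 3 ≼ fromℚ ½
    u≼½ = ≲-trans
      (≼-slack (u 3)
        (fromℚ ½ * (u 0 + (u 1 + u 1 + u 1) + (u 2 + u 2 + u 2) + u 3) +
         fromℚ ½ * ((u 3 + u 2) - (u 1 + u 0)))
        (u 1 + (u 2 + u 2))
        (+-nonneg (u 1) (u 2 + u 2) (u-nonneg 1) (+-nonneg (u 2) (u 2) (u-nonneg 2) (u-nonneg 2)))
        (pointwise λ n → solve 4
          (λ a b c d → d :+ (b :+ (c :+ c)) :=
            con ½ :* (a :+ (b :+ b :+ b) :+ (c :+ c :+ c) :+ d) :+
            con ½ :* ((d :+ c) :- (b :+ a))) refl
          (seq (u 0) n) (seq (u 1) n) (seq (u 2) n) (seq (u 3) n)))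
      (~⇒≲ (total*+μ* ½ ½))

-- Padded pairs and the gap above 2/9.

15/64*γ≼lam⅝ : ∀ DY DN → PaddedOneWisePair {2} (DY , DN) →
               fromℚ (+ 15 / 64) * γ [ 3 ] DY ≼ lam [ 3 ] DN ⅝
15/64*γ≼lam⅝ DY DN (τ , D₀ , DY′ , DN′ , (0≤τ , τ≤1) , μY≈0 , μN≈0 , mixY , mixN) = begin
  c * γ [ 3 ] DY
    ≈⟨ *-congˡ c (γ [ 3 ] DY) (τ * γ [ 3 ] D₀ + σ * γ [ 3 ] DY′)
         (lam-mixture [ 3 ] D₀ DY′ DY τ 1ℝ mixY) ⟩
  c * (τ * γ [ 3 ] D₀ + σ * γ [ 3 ] DY′)
    ≈⟨ distribute c τ σ (γ [ 3 ] D₀) (γ [ 3 ] DY′) ⟩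
  τ * (c * γ [ 3 ] D₀) + σ * (c * γ [ 3 ] DY′)
    ≲⟨ +-mono-≼ (τ * (c * γ [ 3 ] D₀)) (τ * lam [ 3 ] D₀ ⅝)
                (σ * (c * γ [ 3 ] DY′)) (σ * lam [ 3 ] DN′ ⅝)
         (*-monoˡ-≼ τ (c * γ [ 3 ] D₀) (lam [ 3 ] D₀ ⅝) (mk≲ 0≤τ) common)
         (*-monoˡ-≼ σ (c * γ [ 3 ] DY′) (lam [ 3 ] DN′ ⅝) (≼⇒0≼- τ 1ℝ (mk≲ τ≤1)) mean-zero) ⟩
  τ * lam [ 3 ] D₀ ⅝ + σ * lam [ 3 ] DN′ ⅝
    ≈⟨ lam-mixture [ 3 ] D₀ DN′ DN τ ⅝ mixN ⟨
  lam [ 3 ] DN ⅝ ∎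
  where
  open ≼-Reasoning
  c σ : ℝ
  c = fromℚ (+ 15 / 64)
  σ = 1ℝ - τ

  distribute : ∀ c τ σ x y → c * (τ * x + σ * y) ≋ τ * (c * x) + σ * (c * y)
  distribute c τ σ x y = pointwise λ n → solve 5
    (λ c τ σ x y → c :* (τ :* x :+ σ :* y) := τ :* (c :* x) :+ σ :* (c :* y)) refl
    (seq c n) (seq τ n) (seq σ n) (seq x n) (seq y n)
    where open +-*-Solver

  common : c * γ [ 3 ] D₀ ≼ lam [ 3 ] D₀ ⅝
  common = ≲-trans (~⇒≲ (*-congˡ c (γ [ 3 ] D₀) (u D₀ 3) (γ≋u D₀))) (15/64*u≼lam⅝ D₀)

  -- Two mean-zero distributions need not be related, so the comparison passes through the constant
  -- 15/128 = 15/64 · ½.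
  mean-zero : c * γ [ 3 ] DY′ ≼ lam [ 3 ] DN′ ⅝
  mean-zero = begin
    c * γ [ 3 ] DY′    ≈⟨ *-congˡ c (γ [ 3 ] DY′) (u DY′ 3) (γ≋u DY′) ⟩
    c * u DY′ 3        ≲⟨ *-monoˡ-≼ c (u DY′ 3) (fromℚ ½)
                            (fromℚ-mono-≼ (ℚ.nonNegative⁻¹ (+ 15 / 64))) (u≼½ DY′ μY≈0) ⟩
    c * fromℚ ½        ≈⟨ pointwise (λ _ → refl) ⟩
    fromℚ (+ 15 / 128) ≲⟨ 15/128≼lam⅝ DN′ μN≈0 ⟩
    lam [ 3 ] DN′ ⅝    ∎

⅝-UnitInterval : UnitInterval ⅝
⅝-UnitInterval = below (fromℚ-mono-≼ {0ℚ} (from-yes (0ℚ ℚ.≤? + 5 / 8))) ,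
                 below (fromℚ-mono-≼ {q = 1ℚ} (from-yes (+ 5 / 8 ℚ.≤? 1ℚ)))

-- 2/9 + 1/96 = 15/64 − 1/576
scaled≼⇒≼0 : ∀ x → fromℚ (+ 15 / 64) * x ≼ (fromℚ (+ 2 / 9) + fromℚ (+ 1 / 96)) * x → x ≼ 0ℝ
scaled≼⇒≼0 x le = ≼-slack x 0ℝ (fromℚ (+ 576 / 1) * gap)
  (*-fromℚ-nonneg gap (+ 576 / 1)
    (≼⇒0≼- (fromℚ (+ 15 / 64) * x) ((fromℚ (+ 2 / 9) + fromℚ (+ 1 / 96)) * x) le))
  (pointwise λ n → solve 1
    (λ x → x :+ con (+ 576 / 1) :*
             ((con (+ 2 / 9) :+ con (+ 1 / 96)) :* x :- con (+ 15 / 64) :* x) := con 0ℚ)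
    refl (seq x n))
  where
  open +-*-Solver
  gap : ℝ
  gap = (fromℚ (+ 2 / 9) + fromℚ (+ 1 / 96)) * x - fromℚ (+ 15 / 64) * x

-- The gap 15/64 - 2/9 is 7/576, and 1/96 = 6/576 is smaller. A ratio this close to 2/9 would
-- squeeze the denominator `g` to zero, which a finite ratio forbids; `Near` is empty at `∞`.
ratio-not-near : ∀ P r → PaddedOneWisePair {2} P → IsBetaGammaRatio [ 3 ] P r →
                 ¬ Near (fromℚ (+ 2 / 9)) (fromℚ (+ 1 / 96)) r
ratio-not-near (DY , DN) (fin r) padded (b , (upper , _) , (g≉0 , rg≈b)) (_ , r<) =
  g≉0 (close (≲-antisym (scaled≼⇒≼0 g cg≼) 0≼g))
  where
  g : ℝ
  g = γ [ 3 ] DY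

  0≼g : 0ℝ ≼ g
  0≼g = ≲-trans (u-nonneg DY 3) (~⇒≲ (~-sym (γ≋u DY)))

  open ≼-Reasoning

  cg≼ : fromℚ (+ 15 / 64) * g ≼ (fromℚ (+ 2 / 9) + fromℚ (+ 1 / 96)) * g
  cg≼ = begin
    fromℚ (+ 15 / 64) * g                        ≲⟨ 15/64*γ≼lam⅝ DY DN padded ⟩
    lam [ 3 ] DN ⅝                               ≲⟨ mk≲ (upper ⅝ ⅝-UnitInterval) ⟩
    b                                            ≈⟨ mk~ rg≈b ⟨
    r * g                                        ≲⟨ *-monoʳ-≼ g r (fromℚ (+ 2 / 9) + fromℚ (+ 1 / 96)) 0≼g
                                                      (<⇒≼ r (fromℚ (+ 2 / 9) + fromℚ (+ 1 / 96)) r<) ⟩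
    (fromℚ (+ 2 / 9) + fromℚ (+ 1 / 96)) * g     ∎

0<1/96 : 0ℝ < fromℚ (+ 1 / 96)
-- Strict order of reals asks for a positive margin; half of 1/96 serves.
0<1/96 = + 1 / 192 , ℚ.positive⁻¹ (+ 1 / 192) , 0 , λ _ _ → from-yes (+ 1 / 192 ℚ.<? + 1 / 96)

theorem2p12 : ¬ (Σ[ 𝒟 ∈ (ℕ → Δ 3 × Δ 3) ]
    ( (∀ t → PaddedOneWisePair (𝒟 t))
    × (∃[ ρ ] ( (∀ t → IsBetaGammaRatio [ 3 ] (𝒟 t) (ρ t))
    × ConvergesTo ρ (fromℚ (+ 2 / 9)) ))))
theorem2p12 (𝒟 , padded , ρ , ratio , converges) =
  -- A single term of the sequence within 1/96 of the limit already gives the contradiction.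
  let N , near = converges (fromℚ (+ 1 / 96)) 0<1/96
  in ratio-not-near (𝒟 N) (ρ N) (padded N) (ratio N) (near N ℕ.≤-refl)
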